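{- All unit-interval simplicial complexes are skeleton-E-chordal. All interval (also called underclosed) simplicial complexes are skeleton-weakly-chordal.
   Context: Simplicial complexes are finite and not necessarily pure. A vertex labeling of a complex with $n$ vertices is a bijection of its vertices with $[n]=\{1,\dots,n\}$; $\min F,\max F$ denote the smallest and largest labels in $F$; the size of a face is its number of vertices. For sets $G=\{g_0<\dots<g_k\}$, $F=\{f_0<\dots<f_k\}$ of the same size, $G\le F$ componentwise means $g_i\le f_i$ for all $i$. A complex $\Delta$ with $n$ vertices is: - unit-interval, if it has a labeling such that for every facet $F$ of $\Delta$, every subset of $\{\min F,\min F+1,\dots,\max F\}$ of size $|F|$ is a face of $\Delta$; - underclosed (or interval), if it has a labeling such that for every facet $F$ of $\Delta$ and every $G\subseteq[n]$ with $|G|=|F|$, if $\min G=\min F$ and $G\le F$ componentwise, then $G\in\Delta$; - skeleton-E-chordal, if it has a labeling such that for every two faces $f\ne g$ of $\Delta$ with the same size and same maximum, every subset $h\subseteq f\cup g$ with $|h|=|f|$ is a face of $\Delta$; - skeleton-weakly-chordal, if it has a labeling such that for every two faces $f\neq g$ of $\Delta$ with the same size and same maximum, $\Delta$ contains some face $h$ with $|h|=|f|$ and $h\subseteq (f\cup g)\setminus\{\max f\}$. -}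

module Defs where

open import Data.Fin.Base using (Fin; _≤_)
open import Data.Fin.Permutation using (Permutation′; _⟨$⟩ʳ_; _⟨$⟩ˡ_; inverseˡ)
open import Data.Fin.Subset using (Subset; _∈_; _⊆_; _∪_; _-_; ⁅_⁆; ∣_∣; Lift)
open import Data.Fin.Subset.Properties using (_∈?_; x∈⁅x⁆; x∈⁅y⁆⇒x≡y)
open import Data.List.Base using (List; allFin; filter)
open import Data.List.Relation.Binary.Pointwise using (Pointwise)
open import Data.Nat.Base using (ℕ)
open import Data.Product.Base using (∃; _×_)
open import Data.Vec.Base using (lookup; tabulate)
open import Data.Vec.Properties using (lookup∘tabulate; []=⇒lookup; lookup⇒[]=)
open import Level using (0ℓ)
open import Relation.Binary.PropositionalEquality
open import Relation.Unary using (Pred; Decidable)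

-- Membership is required to be decidable: a finite complex is a finite
-- collection of sets, but an arbitrary Set-valued predicate need not be
-- constructively.  The empty set is not required to be a face; for n > 0 this
-- follows from the other fields, and for n = 0 the void complex is allowed
-- alongside { ∅ }.
record SimplicialComplex (n : ℕ) : Set₁ where
  field
    Face        : Pred (Subset n) 0ℓ
    face?       : Decidable Face
    down-closed : ∀ {F G} → G ⊆ F → Face F → Face G
    vertex      : ∀ v → Face ⁅ v ⁆

  Facet : Pred (Subset n) 0ℓ
  Facet F = Face F × (∀ {G} → Face G → F ⊆ G → G ≡ F)

open SimplicialComplex public

-- The labels [n] are represented by Fin n, i.e. by 0, …, n-1.
Labeling : ℕ → Set
Labeling = Permutation′

-- The set of vertices whose labels lie in G.
preimage : ∀ {n} → Labeling n → Subset n → Subset n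
preimage σ G = tabulate λ v → lookup G (σ ⟨$⟩ʳ v)

∈-preimage⁻ : ∀ {n} (σ : Labeling n) {G v} → v ∈ preimage σ G → σ ⟨$⟩ʳ v ∈ G
∈-preimage⁻ σ {G} {v} v∈ = lookup⇒[]= (σ ⟨$⟩ʳ v) G
  (trans (sym (lookup∘tabulate _ v)) ([]=⇒lookup v∈))

∈-preimage⁺ : ∀ {n} (σ : Labeling n) {G v} → σ ⟨$⟩ʳ v ∈ G → v ∈ preimage σ G
∈-preimage⁺ σ {G} {v} σv∈ = lookup⇒[]= v (preimage σ G)
  (trans (lookup∘tabulate _ v) ([]=⇒lookup σv∈))

-- The complex Δ with each vertex v renamed to its label σ v.
relabel : ∀ {n} → Labeling n → SimplicialComplex n → SimplicialComplex n
relabel σ Δ .Face G = Face Δ (preimage σ G)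
relabel σ Δ .face? G = face? Δ (preimage σ G)
relabel σ Δ .down-closed G⊆F = down-closed Δ
  λ v∈ → ∈-preimage⁺ σ (G⊆F (∈-preimage⁻ σ v∈))
relabel σ Δ .vertex i = down-closed Δ singleton (vertex Δ (σ ⟨$⟩ˡ i))
  where
  singleton : preimage σ ⁅ i ⁆ ⊆ ⁅ σ ⟨$⟩ˡ i ⁆
  singleton {v} v∈ = subst (_∈ ⁅ σ ⟨$⟩ˡ i ⁆)
    (trans (cong (σ ⟨$⟩ˡ_) (sym (x∈⁅y⁆⇒x≡y i (∈-preimage⁻ σ v∈)))) (inverseˡ σ))
    (x∈⁅x⁆ (σ ⟨$⟩ˡ i))

-- Minimum and maximum are relations, since they do not exist for the empty set.
IsMin IsMax : ∀ {n} → Fin n → Subset n → Set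
IsMin a F = a ∈ F × Lift (a ≤_) F
IsMax b F = b ∈ F × Lift (_≤ b) F

-- Listed in increasing order, because allFin is.
elements : ∀ {n} → Subset n → List (Fin n)
elements {n} F = filter (_∈? F) (allFin n)

infix 4 _≤ᶜ_

_≤ᶜ_ : ∀ {n} → Subset n → Subset n → Set
G ≤ᶜ F = Pointwise _≤_ (elements G) (elements F)

-- In the two definitions quantifying over facets, the empty facet (which
-- occurs only if n = 0) imposes no condition: the only set of its size is
-- itself, a face.

UnitInterval : ∀ {n} → SimplicialComplex n → Set
UnitInterval {n} Δ = ∃ λ (σ : Labeling n) → let Δσ = relabel σ Δ in
  ∀ {F a b} → Facet Δσ F → IsMin a F → IsMax b F →
  ∀ {G} → Lift (λ x → a ≤ x × x ≤ b) G → ∣ G ∣ ≡ ∣ F ∣ → Face Δσ G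

Underclosed : ∀ {n} → SimplicialComplex n → Set
Underclosed {n} Δ = ∃ λ (σ : Labeling n) → let Δσ = relabel σ Δ in
  ∀ {F a} → Facet Δσ F → IsMin a F →
  ∀ {G} → ∣ G ∣ ≡ ∣ F ∣ → IsMin a G → G ≤ᶜ F → Face Δσ G

SkeletonEChordal : ∀ {n} → SimplicialComplex n → Set
SkeletonEChordal {n} Δ = ∃ λ (σ : Labeling n) → let Δσ = relabel σ Δ in
  ∀ {f g m} → Face Δσ f → Face Δσ g → f ≢ g →
  ∣ f ∣ ≡ ∣ g ∣ → IsMax m f → IsMax m g →
  ∀ {h} → h ⊆ f ∪ g → ∣ h ∣ ≡ ∣ f ∣ → Face Δσ h

SkeletonWeaklyChordal : ∀ {n} → SimplicialComplex n → Set
SkeletonWeaklyChordal {n} Δ = ∃ λ (σ : Labeling n) → let Δσ = relabel σ Δ in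
  ∀ {f g m} → Face Δσ f → Face Δσ g → f ≢ g →
  ∣ f ∣ ≡ ∣ g ∣ → IsMax m f → IsMax m g →
  ∃ λ h → Face Δσ h × ∣ h ∣ ≡ ∣ f ∣ × h ⊆ (f ∪ g) - m

{-# OPTIONS --safe #-}

-- Extend f and g to facets F and G, and assume min F ≤ min G.
--
-- Unit-interval: h lies between min F and max f ≤ max F, so it can be padded
-- with elements of F to a set of size |F| between min F and max F, a face.
--
-- Underclosed: pick x ∈ g outside f and let m be the common maximum.  Then
-- min F ≤ min G ≤ x < m, and h = (f ∖ m) ∪ x works: it is a subset of F if
-- x ∈ F, and otherwise of (F ∖ m) ∪ x, which has the size and the minimum of F
-- and is componentwise below F.
module Submission where

open import Defs
open import Data.Fin.Base using (Fin; zero; suc; _≤_; _<_)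
open import Data.Fin.Properties using (≤-refl; ≤-trans; ≤-total; ≤∧≢⇒<; any?; _≟_)
open import Data.Fin.Subset
open import Data.Fin.Subset.Induction using (⊃-wellFounded; Acc; acc)
open import Data.Fin.Subset.Properties
open import Data.List.Base using (List; []; _∷_; allFin; filter; length; map; tabulate)
open import Data.List.Properties using (map-tabulate; length-map)
open import Data.List.Relation.Binary.Pointwise as Pointwise using (Pointwise; []; _∷_; Pointwise-length)
open import Data.Nat.Base as ℕ using (ℕ; z≤n; s≤s; s<s)
import Data.Nat.Properties as ℕ
open import Data.Product.Base using (_×_; _,_; proj₁; proj₂; ∃)
open import Data.Sum.Base using (_⊎_; inj₁; inj₂; [_,_]′)
open import Data.Vec.Base using ([]; _∷_; here; there; _[_]≔_)
open import Data.Vec.Properties using (lookup∘update; lookup∘update′; lookup⇒[]=; []=⇒lookup; []≔-minimal; []≔-updates)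
open import Function.Base using (_∘_; id)
open import Relation.Binary.PropositionalEquality
open import Relation.Nullary using (yes; no; contradiction)
open import Relation.Nullary.Decidable using (_×-dec_; ¬?; decidable-stable)

private
  variable
    n k : ℕ
    a m x y : Fin n
    p q F G f g h : Subset n

-- Finite subsets: inclusion, size and extrema.

⊈⇒∃ : p ⊈ q → ∃ λ x → x ∈ p × x ∉ q
⊈⇒∃ {p = p} {q} p⊈q with any? (λ x → (x ∈? p) ×-dec ¬? (x ∈? q))
... | yes ∃x = ∃x
... | no ∄x = contradiction
  (λ {x} x∈p → decidable-stable (x ∈? q) λ x∉q → ∄x (x , x∈p , x∉q)) p⊈q

⊄∧⊆⇒≡ : p ⊄ q → p ⊆ q → p ≡ q
⊄∧⊆⇒≡ {p = p} {q} p⊄q p⊆q = ⊆-antisym p⊆q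
  λ {x} x∈q → decidable-stable (x ∈? p) λ x∉p → p⊄q (p⊆q , x , x∈q , x∉p)

∣p∣≡∣q∣∧p≢q⇒p⊈q : ∣ p ∣ ≡ ∣ q ∣ → p ≢ q → p ⊈ q
∣p∣≡∣q∣∧p≢q⇒p⊈q ∣p∣≡∣q∣ p≢q p⊆q =
  p≢q (⊄∧⊆⇒≡ (λ p⊂q → ℕ.<⇒≢ (p⊂q⇒∣p∣<∣q∣ p⊂q) ∣p∣≡∣q∣) p⊆q)

-- Serves to pad a set up to the size of a facet. An element of `q` outside `p` is left out as long
-- as the rest of `q` can still supply `k` elements; once it cannot, all of `q` is taken.
interpolate : p ⊆ q → ∣ p ∣ ℕ.≤ k → k ℕ.≤ ∣ q ∣ → ∃ λ r → p ⊆ r × r ⊆ q × ∣ r ∣ ≡ k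
interpolate {p = []} {[]} _ _ z≤n = [] , id , id , refl
interpolate {p = inside ∷ p} {outside ∷ q} p⊆q _ _ with () ← p⊆q here
interpolate {p = inside ∷ p} {inside ∷ q} p⊆q (s≤s p≤k) (s≤s k≤q) =
  let r , p⊆r , r⊆q , ∣r∣≡k = interpolate (drop-∷-⊆ p⊆q) p≤k k≤q
  in inside ∷ r , s⊆s p⊆r , s⊆s r⊆q , cong ℕ.suc ∣r∣≡k
interpolate {p = outside ∷ p} {outside ∷ q} p⊆q p≤k k≤q =
  let r , p⊆r , r⊆q , ∣r∣≡k = interpolate (drop-∷-⊆ p⊆q) p≤k k≤q
  in outside ∷ r , s⊆s p⊆r , s⊆s r⊆q , ∣r∣≡k
interpolate {p = outside ∷ p} {inside ∷ q} p⊆q p≤k k≤1+q with ℕ.m≤n⇒m<n∨m≡n k≤1+q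
... | inj₂ k≡1+q = inside ∷ q , p⊆q , id , sym k≡1+q
... | inj₁ (s≤s k≤q) =
  let r , p⊆r , r⊆q , ∣r∣≡k = interpolate (drop-∷-⊆ p⊆q) p≤k k≤q
  in outside ∷ r , s⊆s p⊆r , out⊆ r⊆q , ∣r∣≡k

minimum : Nonempty p → ∃ λ a → IsMin a p
minimum {p = inside ∷ p} _ = zero , here , λ _ → z≤n
minimum {p = outside ∷ p} (suc x , there x∈p) =
  let a , a∈p , a≤p = minimum (x , x∈p)
  in suc a , there a∈p , λ { (there y∈p) → s≤s (a≤p y∈p) }

maximum : Nonempty p → ∃ λ b → IsMax b p
maximum {p = s ∷ p} (x , x∈) with nonempty? p
... | yes ne =
  let b , b∈p , p≤b = maximum ne
  in suc b , there b∈p , λ { here → z≤n ; (there y∈p) → s≤s (p≤b y∈p) }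
maximum {p = s ∷ p} (zero , here) | no empty =
  zero , here , λ { here → z≤n ; (there y∈p) → contradiction (_ , y∈p) empty }
maximum {p = s ∷ p} (suc x , there x∈p) | no empty = contradiction (x , x∈p) empty

-- Componentwise comparison and the exchange of one element.

filter-∈?-map-suc : ∀ s (p : Subset n) xs →
  filter (_∈? (s ∷ p)) (map suc xs) ≡ map suc (filter (_∈? p) xs)
filter-∈?-map-suc s p [] = refl
-- `suc x ∈? (s ∷ p)` is decided by `x ∈? p`, so one case split reduces both filters.
filter-∈?-map-suc s p (x ∷ xs) with ih ← filter-∈?-map-suc s p xs | x ∈? p
... | yes _ = cong (suc x ∷_) ih
... | no _ = ih

-- `allFin (suc n)` is `zero` followed by `tabulate suc`, and `s` alone decides whether `zero` is
-- kept. Rewriting with this equation lets `elements` recurse along the vector.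
elements-suc : ∀ s (p : Subset n) →
  filter (_∈? (s ∷ p)) (tabulate suc) ≡ map suc (elements p)
elements-suc {n} s p = trans
  (cong (filter (_∈? (s ∷ p))) (sym (map-tabulate id suc)))
  (filter-∈?-map-suc s p (allFin n))

length-elements : ∀ (p : Subset n) → length (elements p) ≡ ∣ p ∣
length-elements [] = refl
length-elements (inside ∷ p) rewrite elements-suc inside p | length-map suc (elements p) =
  cong ℕ.suc (length-elements p)
length-elements (outside ∷ p) rewrite elements-suc outside p | length-map suc (elements p) =
  length-elements p

-- Yields the size of an exchanged set from its comparison with the original, without a separate
-- count.
≤ᶜ⇒∣∣≡ : p ≤ᶜ q → ∣ p ∣ ≡ ∣ q ∣
≤ᶜ⇒∣∣≡ {p = p} {q} p≤q = trans (sym (length-elements p)) (trans (Pointwise-length p≤q) (length-elements q))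

map-suc-mono : ∀ {xs ys : List (Fin n)} → Pointwise _≤_ xs ys → Pointwise _≤_ (map suc xs) (map suc ys)
map-suc-mono = Pointwise.map⁺ suc suc ∘ Pointwise.map s≤s

lower-head : ∀ {i j : Fin n} {is js} → i ≤ j → Pointwise _≤_ (j ∷ is) js → Pointwise _≤_ (i ∷ is) js
lower-head i≤j (j≤k ∷ is≤js) = ≤-trans i≤j j≤k ∷ is≤js

-- The new `zero` shifts the elements before `m` by one position, so each is compared with its
-- successor in `p`; past `m` the two lists agree.
zero∷[p-m]≤p : m ∈ p → Pointwise _≤_ (zero ∷ map suc (elements (p [ m ]≔ outside))) (map suc (elements p))
zero∷[p-m]≤p {p = _ ∷ p} here
  rewrite elements-suc inside p | elements-suc outside p = z≤n ∷ Pointwise.refl ≤-refl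
zero∷[p-m]≤p {m = suc m} {inside ∷ p} (there m∈p)
  rewrite elements-suc inside p | elements-suc inside (p [ m ]≔ outside) = z≤n ∷ map-suc-mono (zero∷[p-m]≤p m∈p)
zero∷[p-m]≤p {m = suc m} {outside ∷ p} (there m∈p)
  rewrite elements-suc outside p | elements-suc outside (p [ m ]≔ outside) = lower-head z≤n (map-suc-mono (zero∷[p-m]≤p m∈p))

-- Written with _[_]≔_ because (s ∷ p) - suc m does not reduce to s ∷ (p - m).
exchange : Fin n → Fin n → Subset n → Subset n
exchange x m p = (p [ m ]≔ outside) [ x ]≔ inside

-- Positions below `x` are the same in both sets and are peeled off until `x` is `zero`; from there
-- `x` is the new head of `zero∷[p-m]≤p`.
exchange-≤ᶜ : x ∉ p → m ∈ p → x < m → exchange x m p ≤ᶜ p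
exchange-≤ᶜ {x = zero} {inside ∷ p} x∉p _ _ = contradiction here x∉p
exchange-≤ᶜ {x = zero} {outside ∷ p} {suc m} _ (there m∈p) _
  rewrite elements-suc inside (p [ m ]≔ outside) | elements-suc outside p = zero∷[p-m]≤p m∈p
exchange-≤ᶜ {x = suc x} {inside ∷ p} {suc m} x∉p (there m∈p) (s<s x<m)
  rewrite elements-suc inside (exchange x m p) | elements-suc inside p =
  z≤n ∷ map-suc-mono (exchange-≤ᶜ (x∉p ∘ there) m∈p x<m)
exchange-≤ᶜ {x = suc x} {outside ∷ p} {suc m} x∉p (there m∈p) (s<s x<m)
  rewrite elements-suc outside (exchange x m p) | elements-suc outside p =
  map-suc-mono (exchange-≤ᶜ (x∉p ∘ there) m∈p x<m)

∈-remove⁻ : x ∈ p [ m ]≔ outside → x ∈ p × x ≢ m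
∈-remove⁻ {x = x} {p} {m} x∈ with x ≟ m
... | no x≢m = lookup⇒[]= x p (trans (sym (lookup∘update′ x≢m p outside)) ([]=⇒lookup x∈)) , x≢m
... | yes refl with () ← trans (sym (lookup∘update m p outside)) ([]=⇒lookup x∈)

∈-exchange⁻ : x ∈ exchange y m p → x ≡ y ⊎ x ∈ p × x ≢ m
∈-exchange⁻ {x = x} {y} {m} {p} x∈ with x ≟ y
... | yes x≡y = inj₁ x≡y
... | no x≢y = inj₂ (∈-remove⁻ (lookup⇒[]= x (p [ m ]≔ outside)
  (trans (sym (lookup∘update′ x≢y (p [ m ]≔ outside) inside)) ([]=⇒lookup x∈))))

∈-exchange⁺ˡ : y ∈ exchange y m p
∈-exchange⁺ˡ {y = y} {m} {p} = []≔-updates (p [ m ]≔ outside) y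

∈-exchange⁺ʳ : x ∈ p → x ≢ m → x ∈ exchange y m p
∈-exchange⁺ʳ {x = x} {p} {m} {y} x∈p x≢m with x ≟ y
... | yes refl = ∈-exchange⁺ˡ {p = p}
... | no x≢y = []≔-minimal _ x y x≢y ([]≔-minimal p x m x≢m x∈p)

exchange⊆ : y ∈ q → p ⊆ q → exchange y m p ⊆ q
exchange⊆ y∈q p⊆q x∈ with ∈-exchange⁻ x∈
... | inj₁ refl = y∈q
... | inj₂ (x∈p , _) = p⊆q x∈p

exchange-mono : p ⊆ q → exchange y m p ⊆ exchange y m q
exchange-mono p⊆q x∈ with ∈-exchange⁻ x∈
... | inj₁ refl = ∈-exchange⁺ˡ
... | inj₂ (x∈p , x≢m) = ∈-exchange⁺ʳ (p⊆q x∈p) x≢m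

exchange⊆- : y ∈ q → y ≢ m → p ⊆ q → exchange y m p ⊆ q - m
exchange⊆- y∈q y≢m p⊆q x∈ with ∈-exchange⁻ x∈
... | inj₁ refl = x∈p∧x≢y⇒x∈p-y y∈q y≢m
... | inj₂ (x∈p , x≢m) = x∈p∧x≢y⇒x∈p-y (p⊆q x∈p) x≢m

exchange-isMin : IsMin a p → a ≤ y → y < m → IsMin a (exchange y m p)
exchange-isMin (a∈p , a≤p) a≤y y<m =
  -- The minimum survives the removal of `m`, since `a ≤ y < m`.
  ∈-exchange⁺ʳ a∈p (λ { refl → ℕ.<-irrefl refl (ℕ.≤-<-trans a≤y y<m) }) ,
  λ x∈ → [ (λ { refl → a≤y }) , a≤p ∘ proj₁ ]′ (∈-exchange⁻ x∈)

-- Extending faces to facets.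

module _ (Δ : SimplicialComplex n) where

  -- Induction along strict inclusion: a search through all subsets, possible because faces are
  -- decidable, finds a strictly larger face or shows that the present one is maximal.
  facet-above : Face Δ f → ∃ λ F → Facet Δ F × f ⊆ F
  facet-above {f} f∈Δ = go (⊃-wellFounded f) f∈Δ
    where
    go : ∀ {f} → Acc _⊃_ f → Face Δ f → ∃ λ F → Facet Δ F × f ⊆ F
    go {f} (acc rec) f∈Δ with anySubset? (λ g → face? Δ g ×-dec (f ⊂? g))
    ... | yes (g , g∈Δ , f⊂g) =
      let F , facet , g⊆F = go (rec f⊂g) g∈Δ
      in F , facet , g⊆F ∘ p⊂q⇒p⊆q f⊂g
    ... | no maximal = f , (f∈Δ , λ {g} g∈Δ f⊆g →
      sym (⊄∧⊆⇒≡ (λ f⊂g → maximal (g , g∈Δ , f⊂g)) f⊆g)) , id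

  facet-above-min : Face Δ f → m ∈ f → ∃ λ F → Facet Δ F × f ⊆ F × ∃ λ a → IsMin a F
  facet-above-min f∈Δ m∈f =
    let F , facet , f⊆F = facet-above f∈Δ
    in F , facet , f⊆F , minimum (_ , f⊆F m∈f)

  -- Unit-interval complexes.

  module _ (unit-interval : ∀ {F a b} → Facet Δ F → IsMin a F → IsMax b F →
              ∀ {G} → Lift (λ x → a ≤ x × x ≤ b) G → ∣ G ∣ ≡ ∣ F ∣ → Face Δ G) where

    interval-face : Facet Δ F → IsMin a F → m ∈ F →
      Lift (λ x → a ≤ x × x ≤ m) h → ∣ h ∣ ℕ.≤ ∣ F ∣ → Face Δ h
    interval-face {F} {h = h} facet min m∈F bounds ∣h∣≤∣F∣ =
      let b , max = maximum (_ , m∈F)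
          -- Padding inside `h ∪ F` keeps `r` between `a` and `b`, because both `h` and `F` lie
          -- there.
          r , h⊆r , r⊆h∪F , ∣r∣≡∣F∣ = interpolate (p⊆p∪q F) ∣h∣≤∣F∣ (∣q∣≤∣p∪q∣ h F)
      in down-closed Δ h⊆r (unit-interval facet min max
           (λ x∈r → [ (λ x∈h → proj₁ (bounds x∈h) , ≤-trans (proj₂ (bounds x∈h)) (proj₂ max m∈F))
                    , (λ x∈F → proj₂ min x∈F , proj₂ max x∈F) ]′ (x∈p∪q⁻ h F (r⊆h∪F x∈r)))
           ∣r∣≡∣F∣)

    subset-of-union-face : Face Δ f → Face Δ g → ∣ f ∣ ≡ ∣ g ∣ → IsMax m f → IsMax m g →
      h ⊆ f ∪ g → ∣ h ∣ ≡ ∣ f ∣ → Face Δ h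
    subset-of-union-face {f} {g} f∈Δ g∈Δ ∣f∣≡∣g∣ (m∈f , f≤m) (m∈g , g≤m) h⊆f∪g ∣h∣≡∣f∣
      with F , F-facet , f⊆F , a , a-min ← facet-above-min f∈Δ m∈f
         | G , G-facet , g⊆G , c , c-min ← facet-above-min g∈Δ m∈g
      with ≤-total a c
    ... | inj₁ a≤c = interval-face F-facet a-min (f⊆F m∈f)
      (λ x∈h → [ (λ x∈f → proj₂ a-min (f⊆F x∈f) , f≤m x∈f)
               , (λ x∈g → ≤-trans a≤c (proj₂ c-min (g⊆G x∈g)) , g≤m x∈g) ]′
               (x∈p∪q⁻ f g (h⊆f∪g x∈h)))
      (ℕ.≤-trans (ℕ.≤-reflexive ∣h∣≡∣f∣) (p⊆q⇒∣p∣≤∣q∣ f⊆F))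
    ... | inj₂ c≤a = interval-face G-facet c-min (g⊆G m∈g)
      (λ x∈h → [ (λ x∈f → ≤-trans c≤a (proj₂ a-min (f⊆F x∈f)) , f≤m x∈f)
               , (λ x∈g → proj₂ c-min (g⊆G x∈g) , g≤m x∈g) ]′
               (x∈p∪q⁻ f g (h⊆f∪g x∈h)))
      (ℕ.≤-trans (ℕ.≤-reflexive (trans ∣h∣≡∣f∣ ∣f∣≡∣g∣)) (p⊆q⇒∣p∣≤∣q∣ g⊆G))

  -- Underclosed complexes.

  module _ (underclosed : ∀ {F a} → Facet Δ F → IsMin a F →
              ∀ {G} → ∣ G ∣ ≡ ∣ F ∣ → IsMin a G → G ≤ᶜ F → Face Δ G) where

    exchange-face : Facet Δ F → IsMin a F → f ⊆ F → m ∈ f → a ≤ x → x < m →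
      Face Δ (exchange x m f)
    exchange-face {F} {x = x} facet min f⊆F m∈f a≤x x<m with x ∈? F
    ... | yes x∈F = down-closed Δ (exchange⊆ x∈F f⊆F) (proj₁ facet)
    ... | no x∉F =
      -- The exchange is made in `F`, since the hypothesis concerns facets; monotonicity then passes
      -- down to `f`.
      let below = exchange-≤ᶜ x∉F (f⊆F m∈f) x<m
      in down-closed Δ (exchange-mono f⊆F)
           (underclosed facet min (≤ᶜ⇒∣∣≡ below) (exchange-isMin min a≤x x<m) below)

    -- Asymmetric in `f` and `g`: all that is asked of the minima is that `a` bounds `g` from below,
    -- so either order of the two minima can be served by naming the faces accordingly.
    exchange-in-union : Facet Δ F → IsMin a F → f ⊆ F → Lift (a ≤_) g →
      f ≢ g → ∣ f ∣ ≡ ∣ g ∣ → m ∈ f → IsMax m g →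
      ∃ λ h → Face Δ h × ∣ h ∣ ≡ ∣ f ∣ × h ⊆ (f ∪ g) - m
    exchange-in-union {f = f} {g} {m} facet min f⊆F a≤g f≢g ∣f∣≡∣g∣ m∈f (_ , g≤m) =
      -- Distinct sets of equal size are not nested, which provides `x`.
      let x , x∈g , x∉f = ⊈⇒∃ (∣p∣≡∣q∣∧p≢q⇒p⊈q (sym ∣f∣≡∣g∣) (≢-sym f≢g))
          x≢m = λ { refl → x∉f m∈f }
          x<m = ≤∧≢⇒< (g≤m x∈g) x≢m
      in exchange x m f
       , exchange-face facet min f⊆F m∈f (a≤g x∈g) x<m
       , ≤ᶜ⇒∣∣≡ (exchange-≤ᶜ x∉f m∈f x<m)
       , exchange⊆- (q⊆p∪q f g x∈g) x≢m (p⊆p∪q g)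

    face-in-union-minus-max : Face Δ f → Face Δ g → f ≢ g → ∣ f ∣ ≡ ∣ g ∣ → IsMax m f → IsMax m g →
      ∃ λ h → Face Δ h × ∣ h ∣ ≡ ∣ f ∣ × h ⊆ (f ∪ g) - m
    face-in-union-minus-max {f} {g} {m} f∈Δ g∈Δ f≢g ∣f∣≡∣g∣ f-max g-max
      with F , F-facet , f⊆F , a , a-min ← facet-above-min f∈Δ (proj₁ f-max)
         | G , G-facet , g⊆G , c , c-min ← facet-above-min g∈Δ (proj₁ g-max)
      with ≤-total a c
    ... | inj₁ a≤c = exchange-in-union F-facet a-min f⊆F
      (λ x∈g → ≤-trans a≤c (proj₂ c-min (g⊆G x∈g))) f≢g ∣f∣≡∣g∣ (proj₁ f-max) g-max
    -- The roles of `f` and `g` are swapped, so the size and the union are carried back.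
    ... | inj₂ c≤a =
      let h , h∈Δ , ∣h∣≡∣g∣ , h⊆ = exchange-in-union G-facet c-min g⊆G
            (λ x∈f → ≤-trans c≤a (proj₂ a-min (f⊆F x∈f)))
            (≢-sym f≢g) (sym ∣f∣≡∣g∣) (proj₁ g-max) f-max
      in h , h∈Δ , trans ∣h∣≡∣g∣ (sym ∣f∣≡∣g∣) , subst (λ u → h ⊆ u - m) (∪-comm g f) h⊆

theorem5 : (∀ n (Δ : SimplicialComplex n) → UnitInterval Δ → SkeletonEChordal Δ)
    × (∀ n (Δ : SimplicialComplex n) → Underclosed Δ → SkeletonWeaklyChordal Δ)
theorem5 =
  -- The labeling given by the hypothesis serves for the conclusion too: after relabeling, vertices
  -- are their own labels.
  (λ n Δ (σ , ui) → σ , λ f∈ g∈ _ eq f-max g-max → subset-of-union-face (relabel σ Δ) ui f∈ g∈ eq f-max g-max) ,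
  (λ n Δ (σ , uc) → σ , face-in-union-minus-max (relabel σ Δ) uc)
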